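{- Let $p$ be a prime and let $A,B\subseteq\mathbb{Z}/p\mathbb{Z}$ be non-empty. If $|A|<p/2$ and $|B|<\sqrt{|A|}+1$, then for every mapping $\tau\colon B\to A$ we have $|A\stackrel{\tau}{+}B|\ge |A|+|B|-3$.
   Context: $\mathbb{Z}/p\mathbb{Z}$ is the cyclic group of prime order $p$. For a mapping $\tau\colon B\to A$, the restricted sumset is $A\stackrel{\tau}{+}B:=\{a+b: a\in A,\ b\in B,\ a\ne\tau(b)\}$. -}

module Defs where

open import Data.Nat using (ℕ; _+_; NonZero)
open import Data.Nat.DivMod using (_mod_)
open import Data.Fin using (Fin; toℕ; _≟_)
open import Data.Fin.Properties using (any?)
open import Data.Fin.Subset using (Subset; _∈_)
open import Data.Fin.Subset.Properties using (_∈?_)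
open import Data.Vec using (tabulate)
open import Data.Product using (∃; _×_; _,_)
open import Relation.Nullary using (¬_; Dec; does)
open import Relation.Nullary.Decidable using (_×-dec_; ¬?)
open import Relation.Binary.PropositionalEquality using (_≡_)

_+ₚ_ : {p : ℕ} .{{_ : NonZero p}} → Fin p → Fin p → Fin p
_+ₚ_ {p} x y = (toℕ x + toℕ y) mod p

IsRestrictedSum : {p : ℕ} .{{_ : NonZero p}} →
  (A B : Subset p) → (Fin p → Fin p) → Fin p → Set
IsRestrictedSum A B τ x =
  ∃ λ a → ∃ λ b → (a ∈ A × b ∈ B × ¬ (a ≡ τ b) × a +ₚ b ≡ x)

isRestrictedSum? : {p : ℕ} .{{_ : NonZero p}} →
  (A B : Subset p) (τ : Fin p → Fin p) (x : Fin p) → Dec (IsRestrictedSum A B τ x)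
isRestrictedSum? A B τ x =
  any? λ a → any? λ b →
    (a ∈? A) ×-dec ((b ∈? B) ×-dec (¬? (a ≟ τ b) ×-dec ((a +ₚ b) ≟ x)))

restrictedSumset : {p : ℕ} .{{_ : NonZero p}} →
  (A B : Subset p) → (Fin p → Fin p) → Subset p
restrictedSumset A B τ = tabulate λ x → does (isRestrictedSum? A B τ x)

{-# OPTIONS --safe #-}
module Submission where

-- Write m = |A|, n = |B|, q = n − 2, let S be the restricted sumset and
-- λ(d) = |{x ∈ A : x + d ∉ A}|. Since S contains A + b up to one point for
-- every b ∈ B, λ(b − b′) ≤ |S| + 2 − m, so |S| < m + n − 3 forces λ ≤ q on
-- B − B. As λ is subadditive, Cauchy–Davenport shows that at least
-- 2k(q + 1) + 1 residues d satisfy λ(d) ≤ kq, as long as this number does not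
-- exceed p; since p > 2m, this covers all k ≤ m/(q + 1). Summing m − λ(d) over
-- the resulting layers gives more than m², whereas Σ_d (m − λ(d)) = m² exactly.

open import Defs
open import Algebra.Bundles using (AbelianGroup)
import Algebra.Properties.Group as GroupProperties
import Algebra.Properties.CommutativeSemigroup as CommutativeSemigroupProperties
open import Data.Bool using (Bool; true; false; T; not; _∧_; _∨_)
open import Data.Bool.Properties using (T?; T-≡; T-∧; T-∨; ∧-idem)
open import Data.Empty using (⊥; ⊥-elim)
open import Data.Fin using (Fin; zero; suc; toℕ; _≟_)
open import Data.Fin.Permutation using (permutation)
open import Data.Fin.Properties using (any?; toℕ<n; toℕ-injective; toℕ-fromℕ<)
open import Data.Fin.Subset using (Subset; _∈_; ∣_∣; Nonempty; ⁅_⁆)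
open import Data.Fin.Subset.Properties using (x∈⁅x⁆; ∣⁅x⁆∣≡1)
open import Data.Nat
  using (ℕ; zero; suc; pred; _+_; _*_; _∸_; _<_; _≤_; NonZero; z≤n; s≤s; _≤ᵇ_; ≢-nonZero)
open import Data.Nat.Coprimality using (prime⇒coprime; coprime-Bézout)
open import Data.Nat.DivMod
  using (_/_; _%_; _mod_; m%n<n; m<n⇒m%n≡m; n%n≡0; m*n%n≡0; [m+kn]%n≡m%n; %-distribˡ-+;
    m≡m%n+[m/n]*n; m*n/n≡m; m/n*n≤m; /-monoˡ-≤)
open import Data.Nat.GCD using (module Bézout)
open import Data.Nat.Primality using (Prime)
open import Data.Nat.Properties hiding (_≟_)
open import Data.Nat.Tactic.RingSolver using (solve-∀)
open import Data.Product using (∃; _,_; proj₁; proj₂)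
open import Data.Sum using (_⊎_; inj₁; inj₂)
open import Data.Vec using ([]; _∷_; lookup; tabulate)
open import Data.Vec.Properties using (lookup∘tabulate; lookup⇒[]=; []=⇒lookup)
open import Function using (_∘_; Equivalence)
open import Relation.Binary.PropositionalEquality
  using (_≡_; _≢_; refl; sym; trans; cong; cong₂; subst; subst₂; isEquivalence; module ≡-Reasoning)
open import Relation.Nullary using (¬_; yes; no; does)
open import Relation.Nullary.Decidable using (_×-dec_; ¬?; dec-true; decidable-stable)
open import Algebra.Properties.Semiring.Sum +-*-semiring
  using (sum; sum-syntax; sum-cong-≗; ∑-distrib-+; ∑-comm; ∑-permute;
    *-distribˡ-sum; *-distribʳ-sum)

-- Indicator functions and finite sums

χ : Bool → ℕ
χ true  = 1
χ false = 0

χ-mono : ∀ {a b} → (T a → T b) → χ a ≤ χ b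
χ-mono {false}        h = z≤n
χ-mono {true} {true}  h = ≤-refl
χ-mono {true} {false} h = ⊥-elim (h _)

χ-∧ : ∀ a b → χ (a ∧ b) ≡ χ a * χ b
χ-∧ true  b = sym (+-identityʳ (χ b))
χ-∧ false b = refl

χ-∨∧ : ∀ a b → χ (a ∨ b) + χ (b ∧ a) ≡ χ a + χ b
χ-∨∧ true  true  = refl
χ-∨∧ true  false = refl
χ-∨∧ false true  = refl
χ-∨∧ false false = refl

χ-∧-split : ∀ a b → χ (a ∧ b) + χ (a ∧ not b) ≡ χ a
χ-∧-split true  true  = refl
χ-∧-split true  false = refl
χ-∧-split false b     = refl

-- Pointwise form of `A ∖ C ⊆ (A ∖ B) ∪ (B ∖ C)`, the source of the subadditivity of `loss`.
χ-∧-not-triangle : ∀ a b c → χ (a ∧ not c) ≤ χ (a ∧ not b) + χ (b ∧ not c)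
χ-∧-not-triangle false b     c = z≤n
χ-∧-not-triangle true  true  c = ≤-refl
χ-∧-not-triangle true  false c = χ-mono {not c} {true} _

χ-⊎ : ∀ {a b} → T a ⊎ T b → 1 ≤ χ a + χ b
χ-⊎ {true}         _        = s≤s z≤n
χ-⊎ {false} {true} (inj₂ _) = ≤-refl

∑-mono-≤ : ∀ {n} {f g : Fin n → ℕ} → (∀ i → f i ≤ g i) → sum f ≤ sum g
∑-mono-≤ {zero}  h = z≤n
∑-mono-≤ {suc n} h = +-mono-≤ (h zero) (∑-mono-≤ (h ∘ suc))

∑-mono-< : ∀ {n} {f g : Fin n → ℕ} → (∀ i → f i ≤ g i) → ∀ j → f j < g j → sum f < sum g
∑-mono-< h zero    lt = +-mono-<-≤ lt (∑-mono-≤ (h ∘ suc))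
∑-mono-< h (suc j) lt = +-mono-≤-< (h zero) (∑-mono-< (h ∘ suc) j lt)

card : ∀ {n} → (Fin n → Bool) → ℕ
card f = sum (χ ∘ f)

card-mono : ∀ {n} {f g : Fin n → Bool} → (∀ i → T (f i) → T (g i)) → card f ≤ card g
card-mono h = ∑-mono-≤ (λ i → χ-mono (h i))

card-nonempty : ∀ {n} (f : Fin n → Bool) i → T (f i) → 1 ≤ card f
card-nonempty f zero    t = m≤n⇒m≤n+o _ (χ-mono {true} (λ _ → t))
card-nonempty f (suc i) t = m≤n⇒m≤o+n _ (card-nonempty (f ∘ suc) i t)

card-universal : ∀ {n} (f : Fin n → Bool) → (∀ i → T (f i)) → n ≤ card f
card-universal {zero}  f h = z≤n
card-universal {suc n} f h =
  +-mono-≤ (χ-mono {true} (λ _ → h zero)) (card-universal (f ∘ suc) (h ∘ suc))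

∈⇒T : ∀ {n} {A : Subset n} {x} → x ∈ A → T (lookup A x)
∈⇒T x∈A = Equivalence.from T-≡ ([]=⇒lookup x∈A)

T⇒∈ : ∀ {n} {A : Subset n} {x} → T (lookup A x) → x ∈ A
T⇒∈ {A = A} {x} t = lookup⇒[]= x A (Equivalence.to T-≡ t)

∣∣≡card : ∀ {n} (A : Subset n) → ∣ A ∣ ≡ card (lookup A)
∣∣≡card []          = refl
∣∣≡card (true  ∷ A) = cong suc (∣∣≡card A)
∣∣≡card (false ∷ A) = ∣∣≡card A

∣tabulate∣≡card : ∀ {n} (f : Fin n → Bool) → ∣ tabulate f ∣ ≡ card f
∣tabulate∣≡card f =
  trans (∣∣≡card (tabulate f)) (sum-cong-≗ λ i → cong χ (lookup∘tabulate f i))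

card-⁅⁆ : ∀ {n} (c : Fin n) → card (lookup ⁅ c ⁆) ≡ 1
card-⁅⁆ c = trans (sym (∣∣≡card ⁅ c ⁆)) (∣⁅x⁆∣≡1 c)

≡⇒T⁅⁆ : ∀ {n} {i c : Fin n} → i ≡ c → T (lookup ⁅ c ⁆ i)
≡⇒T⁅⁆ {c = c} refl = ∈⇒T (x∈⁅x⁆ c)

card-subsingleton : ∀ {n} (f : Fin n → Bool) c → (∀ i → T (f i) → i ≡ c) → card f ≤ 1
card-subsingleton f c h =
  ≤-trans (card-mono {g = lookup ⁅ c ⁆} λ i t → ≡⇒T⁅⁆ (h i t)) (≤-reflexive (card-⁅⁆ c))

-- Layer-cake decomposition

≤ᵇ-true : ∀ {m n} → m ≤ n → (m ≤ᵇ n) ≡ true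
≤ᵇ-true m≤n = Equivalence.to T-≡ (≤⇒≤ᵇ m≤n)

-- This is `q` times the number of `k < s` with `l ≤ k * q`, a step function lying below
-- `s * q ∸ l`.
layers : (q s l : ℕ) → ℕ
layers q zero    l = 0
layers q (suc s) l = layers q s l + q * χ (l ≤ᵇ s * q)

-- If `j ≤ s` is least with `l ≤ j * q`, the left side is `(s * q + M) - j * q`; if there is no such
-- `j`, it vanishes. The extra height `M` is arbitrary so that the induction can merge the top layer
-- into it, passing to `q + M`.
layers-≤ : ∀ q s M l → layers q s l + M * χ (l ≤ᵇ s * q) ≤ (s * q + M) ∸ l
layers-≤ q zero    M zero    = ≤-reflexive (*-identityʳ M)
layers-≤ q zero    M (suc l) = ≤-trans (≤-reflexive (*-zeroʳ M)) z≤n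
layers-≤ q (suc s) M l with l ≤ᵇ s * q in eq | layers-≤ q s
... | true | ih
  rewrite ≤ᵇ-true (≤-trans (≤ᵇ⇒≤ l (s * q) (Equivalence.from T-≡ eq)) (m≤n+m (s * q) q)) = begin
  layers q s l + q * 1 + M * 1         ≡⟨ e₁ (layers q s l) q M ⟩
  layers q s l + (q + M) * 1           ≡⟨ cong (λ b → layers q s l + (q + M) * χ b) eq ⟨
  layers q s l + (q + M) * χ (l ≤ᵇ s * q) ≤⟨ ih (q + M) l ⟩
  (s * q + (q + M)) ∸ l                ≡⟨ cong (_∸ l) (e₂ (s * q) q M) ⟩
  (q + s * q + M) ∸ l                  ∎
  where
  open ≤-Reasoning
  e₁ : ∀ a b c → a + b * 1 + c * 1 ≡ a + (b + c) * 1
  e₁ = solve-∀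
  e₂ : ∀ a b c → a + (b + c) ≡ b + a + c
  e₂ = solve-∀
... | false | ih = begin
  layers q s l + q * 0 + M * b  ≡⟨ cong (λ z → layers q s l + z + M * b) (*-zeroʳ q) ⟩
  layers q s l + 0 + M * b      ≡⟨ cong (_+ M * b) lower-layers-vanish ⟩
  M * b                         ≤⟨ top (l ≤ᵇ q + s * q) (≤ᵇ⇒≤ l (q + s * q)) ⟩
  (q + s * q + M) ∸ l           ∎
  where
  open ≤-Reasoning
  b = χ (l ≤ᵇ q + s * q)
  sq≱l : ¬ (l ≤ s * q)
  sq≱l le with () ← trans (sym eq) (≤ᵇ-true le)
  -- Since `l` exceeds `s * q`, the induction hypothesis with `M = 0` has right side 0.
  lower-layers-vanish : layers q s l + 0 ≡ 0
  lower-layers-vanish = n≤0⇒n≡0 (≤-trans (ih 0 l) (≤-reflexive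
    (m≤n⇒m∸n≡0 (≤-trans (≤-reflexive (+-identityʳ (s * q))) (<⇒≤ (≰⇒> sq≱l))))))
  top : ∀ c → (T c → l ≤ q + s * q) → M * χ c ≤ (q + s * q + M) ∸ l
  top false h = ≤-trans (≤-reflexive (*-zeroʳ M)) z≤n
  top true  h = ≤-trans (≤-reflexive (*-identityʳ M))
    (≤-trans (m≤n+m M (q + s * q ∸ l)) (≤-reflexive (sym (+-∸-comm M (h _)))))

-- The lower bounds on `L` and `C` together exceed `m * m` by `m * (t + 2) - r * (t + 1 + r)`, which
-- is positive because `r ≤ m` and `r * r < m`. Writing `s = Q + t` encodes `Q ≤ s`; the summand
-- `q * s * Q` is carried along to avoid subtraction.
quadratic-gap : ∀ q t r L C → r ≤ q →
  let Q = suc q ; s = Q + t ; m = s * Q + r in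
  q * (s + s * s * Q) ≤ L + q * s * Q → suc (s * (2 * Q)) ≤ C → L + (s + r) * C ≤ m * m → ⊥
quadratic-gap q t r L C r≤q L-bound C-bound upper =
 <⇒≱ r-small (+-cancelˡ-≤ (m * m + q * s * Q) _ _ (begin
  m * m + q * s * Q + m * (t + 2)
    ≡⟨ e₁ q t r ⟩
  q * (s + s * s * Q) + (s + r) * suc (s * (2 * Q)) + r * (t + 1 + r)
    ≤⟨ +-monoˡ-≤ (r * (t + 1 + r)) (+-mono-≤ L-bound (*-monoʳ-≤ (s + r) C-bound)) ⟩
  L + q * s * Q + (s + r) * C + r * (t + 1 + r)
    ≡⟨ cong (_+ r * (t + 1 + r)) (e₂ L (q * s * Q) ((s + r) * C)) ⟩
  L + (s + r) * C + q * s * Q + r * (t + 1 + r)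
    ≤⟨ +-monoˡ-≤ (r * (t + 1 + r)) (+-monoˡ-≤ (q * s * Q) upper) ⟩
  m * m + q * s * Q + r * (t + 1 + r) ∎))
  where
  open ≤-Reasoning
  Q = suc q
  s = Q + t
  m = s * Q + r
  e₁ : ∀ q t r →
    let Q = suc q ; s = Q + t ; m = s * Q + r in
    m * m + q * s * Q + m * (t + 2) ≡
      q * (s + s * s * Q) + (s + r) * suc (s * (2 * Q)) + r * (t + 1 + r)
  e₁ = solve-∀
  e₂ : ∀ a b c → a + b + c ≡ a + c + b
  e₂ = solve-∀
  e₃ : ∀ a t → a * (t + 1) + a ≡ a * (t + 2)
  e₃ = solve-∀
  -- Here `r < Q ≤ s`, so `r * r < Q * Q ≤ s * Q ≤ m`.
  r²<m : r * r < m
  r²<m = ≤-trans (*-mono-< (s≤s r≤q) (s≤s r≤q))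
    (≤-trans (*-monoˡ-≤ Q (m≤m+n Q t)) (m≤m+n (s * Q) r))
  r-small : r * (t + 1 + r) < m * (t + 2)
  r-small = begin-strict
    r * (t + 1 + r)         ≡⟨ *-distribˡ-+ r (t + 1) r ⟩
    r * (t + 1) + r * r     <⟨ +-mono-≤-< (*-monoˡ-≤ (t + 1) (m≤n+m r (s * Q))) r²<m ⟩
    m * (t + 1) + m         ≡⟨ e₃ m t ⟩
    m * (t + 2)             ∎

-- The cyclic group ℤ/p

module _ {p : ℕ} .{{_ : NonZero p}} where

  [_] : ℕ → Fin p
  [ k ] = k mod p

  toℕ-[] : ∀ k → toℕ [ k ] ≡ k % p
  toℕ-[] k = toℕ-fromℕ< (m%n<n k p)

  []-cong : ∀ {j k} → j % p ≡ k % p → [ j ] ≡ [ k ]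
  []-cong {j} {k} eq = toℕ-injective (trans (toℕ-[] j) (trans eq (sym (toℕ-[] k))))

  []-toℕ : ∀ x → [ toℕ x ] ≡ x
  []-toℕ x = toℕ-injective (trans (toℕ-[] (toℕ x)) (m<n⇒m%n≡m (toℕ<n x)))

  []-+ : ∀ j k → [ j ] +ₚ [ k ] ≡ [ j + k ]
  []-+ j k = []-cong (trans (cong₂ (λ a b → (a + b) % p) (toℕ-[] j) (toℕ-[] k))
    (sym (%-distribˡ-+ j k p)))

  []-+-multiple : ∀ j k → [ j + k * p ] ≡ [ j ]
  []-+-multiple j k = []-cong ([m+kn]%n≡m%n j k p)

  -ₚ_ : Fin p → Fin p
  -ₚ x = [ p ∸ toℕ x ]

  infix 21 -ₚ_

  +ₚ-comm : ∀ x y → x +ₚ y ≡ y +ₚ x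
  +ₚ-comm x y = cong [_] (+-comm (toℕ x) (toℕ y))

  +ₚ-assoc : ∀ x y z → (x +ₚ y) +ₚ z ≡ x +ₚ (y +ₚ z)
  +ₚ-assoc x y z = begin
    [ a + b ] +ₚ z        ≡⟨ cong ([ a + b ] +ₚ_) ([]-toℕ z) ⟨
    [ a + b ] +ₚ [ c ]    ≡⟨ []-+ (a + b) c ⟩
    [ a + b + c ]         ≡⟨ cong [_] (+-assoc a b c) ⟩
    [ a + (b + c) ]       ≡⟨ []-+ a (b + c) ⟨
    [ a ] +ₚ [ b + c ]    ≡⟨ cong (_+ₚ [ b + c ]) ([]-toℕ x) ⟩
    x +ₚ [ b + c ]        ∎
    where
    open ≡-Reasoning
    a = toℕ x
    b = toℕ y
    c = toℕ z

  +ₚ-identityʳ : ∀ x → x +ₚ [ 0 ] ≡ x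
  +ₚ-identityʳ x = begin
    x +ₚ [ 0 ]             ≡⟨ cong (_+ₚ [ 0 ]) ([]-toℕ x) ⟨
    [ toℕ x ] +ₚ [ 0 ]     ≡⟨ []-+ (toℕ x) 0 ⟩
    [ toℕ x + 0 ]          ≡⟨ cong [_] (+-identityʳ (toℕ x)) ⟩
    [ toℕ x ]              ≡⟨ []-toℕ x ⟩
    x                      ∎
    where open ≡-Reasoning

  +ₚ-inverseʳ : ∀ x → x +ₚ -ₚ x ≡ [ 0 ]
  +ₚ-inverseʳ x = begin
    x +ₚ [ p ∸ toℕ x ]           ≡⟨ cong (_+ₚ [ p ∸ toℕ x ]) ([]-toℕ x) ⟨
    [ toℕ x ] +ₚ [ p ∸ toℕ x ]   ≡⟨ []-+ (toℕ x) (p ∸ toℕ x) ⟩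
    [ toℕ x + (p ∸ toℕ x) ]      ≡⟨ cong [_] (m+[n∸m]≡n (<⇒≤ (toℕ<n x))) ⟩
    [ p ]                        ≡⟨ []-cong (trans (n%n≡0 p) (sym (m*n%n≡0 0 p))) ⟩
    [ 0 ]                        ∎
    where open ≡-Reasoning

  +ₚ-abelianGroup : AbelianGroup _ _
  +ₚ-abelianGroup = record
    { Carrier = Fin p ; _≈_ = _≡_ ; _∙_ = _+ₚ_ ; ε = [ 0 ] ; _⁻¹ = -ₚ_
    ; isAbelianGroup = record
      { isGroup = record
        { isMonoid = record
          { isSemigroup = record
            { isMagma = record { isEquivalence = isEquivalence ; ∙-cong = cong₂ _+ₚ_ }
            ; assoc = +ₚ-assoc }
          ; identity = (λ x → trans (+ₚ-comm [ 0 ] x) (+ₚ-identityʳ x)) , +ₚ-identityʳ }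
        ; inverse = (λ x → trans (+ₚ-comm (-ₚ x) x) (+ₚ-inverseʳ x)) , +ₚ-inverseʳ
        ; ⁻¹-cong = cong -ₚ_ }
      ; comm = +ₚ-comm } }

  open AbelianGroup +ₚ-abelianGroup using (group; commutativeSemigroup)
  open GroupProperties group using (//-rightDividesˡ; //-rightDividesʳ; ⁻¹-involutive; x∙y⁻¹≈ε⇒x≈y)
  open CommutativeSemigroupProperties commutativeSemigroup using (x∙yz≈y∙xz)

  ∑-translate : ∀ (f : Fin p → ℕ) c → ∑[ x < p ] f (x +ₚ c) ≡ sum f
  ∑-translate f c = sym (∑-permute f
    (permutation (_+ₚ c) (_+ₚ -ₚ c) (//-rightDividesˡ c) (//-rightDividesʳ c)))

  card-negate : ∀ (X : Fin p → Bool) → card (X ∘ -ₚ_) ≡ card X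
  card-negate X = sym (∑-permute (χ ∘ X) (permutation -ₚ_ -ₚ_ ⁻¹-involutive ⁻¹-involutive))

  -- Cauchy–Davenport

  -- A nonzero `d` is invertible modulo the prime `p`, so every residue is a multiple of `d`, and
  -- repeated translation by `d` leads from `x` to any `y`.
  translation-closed⇒universal : Prime p → (X : Fin p → Bool) (d : Fin p) → d ≢ [ 0 ] →
    (∀ x → T (X x) → T (X (x +ₚ d))) → ∀ x → T (X x) → ∀ y → T (X y)
  translation-closed⇒universal p-prime X d d≢0 closed x x∈X y =
    subst (T ∘ X) (trans (cong (x +ₚ_) ([]-toℕ _)) (trans (+ₚ-comm x _) (//-rightDividesˡ x y)))
      (stable-all (coprime-Bézout (prime⇒coprime p-prime (toℕ<n d))) (toℕ (y +ₚ -ₚ x)) x x∈X)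
    where
    Stable : ℕ → Set
    Stable t = ∀ x → T (X x) → T (X (x +ₚ [ t ]))

    instance
      d-nonZero : NonZero (toℕ d)
      d-nonZero = ≢-nonZero λ eq → d≢0 (trans (sym ([]-toℕ d)) (cong [_] eq))

    stable-* : ∀ k {t} → Stable t → Stable (k * t)
    stable-* zero    st x m = subst (T ∘ X) (sym (+ₚ-identityʳ x)) m
    stable-* (suc k) {t} st x m =
      subst (T ∘ X) (trans (+ₚ-assoc x [ t ] [ k * t ]) (cong (x +ₚ_) ([]-+ t (k * t))))
        (stable-* k st (x +ₚ [ t ]) (st x m))

    stable-d : Stable (toℕ d)
    stable-d x m = subst (λ z → T (X (x +ₚ z))) (sym ([]-toℕ d)) (closed x m)

    stable-cong : ∀ {s t} → [ s ] ≡ [ t ] → Stable s → Stable t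
    stable-cong eq st x m = subst (λ z → T (X (x +ₚ z))) eq (st x m)

    stable-all : Bézout.Identity 1 p (toℕ d) → ∀ t → Stable t
    stable-all (Bézout.-+ u v eq) t = stable-cong
      (trans (cong [_] (trans (cong (t *_) (sym eq)) (e t u p))) ([]-+-multiple t (t * u)))
      (stable-* t (stable-* v stable-d))
      where
      e : ∀ t u p → t * (1 + u * p) ≡ t + t * u * p
      e = solve-∀
    -- In this case `v * toℕ d` is -1 modulo `p`; the further factor `pred p`, also -1, corrects the
    -- sign.
    stable-all (Bézout.+- u v eq) t = stable-cong
      (trans (sym ([]-+-multiple (t * (pred p * N)) (t * u)))
        (trans (cong [_] shifted) ([]-+-multiple t (t * N))))
      (stable-* t (stable-* (pred p) (stable-* v stable-d)))
      where
      open ≡-Reasoning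
      N = v * toℕ d
      e : ∀ t w N → t * (w * N) + t * (1 + N) ≡ t + t * N * suc w
      e = solve-∀
      shifted : t * (pred p * N) + t * u * p ≡ t + t * N * p
      shifted = begin
        t * (pred p * N) + t * u * p
          ≡⟨ cong (t * (pred p * N) +_) (trans (*-assoc t u p) (cong (t *_) (sym eq))) ⟩
        t * (pred p * N) + t * (1 + N)   ≡⟨ e t (pred p) N ⟩
        t + t * N * suc (pred p)         ≡⟨ cong (λ z → t + t * N * z) (suc-pred p) ⟩
        t + t * N * p                    ∎

  -- Induction on a bound for `card B`. The threshold `t` expresses min(p, |X| + |B| - 1) without
  -- minimum or subtraction. Allowing any `Y` that contains the sumset lets `Y` stay fixed while `X`
  -- and `B` change.
  cauchy-davenport : Prime p → (X B Y : Fin p → Bool) → ∃ (T ∘ X) → ∃ (T ∘ B) →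
    (∀ x b → T (X x) → T (B b) → T (Y (x +ₚ b))) →
    ∀ t → t ≤ p → t < card X + card B → t ≤ card Y
  cauchy-davenport p-prime X B Y ∃X ∃B X+B⊆Y t t≤p = go (card B) X B ≤-refl ∃X ∃B X+B⊆Y
    where
    go : ∀ N (X B : Fin p → Bool) → card B ≤ N → ∃ (T ∘ X) → ∃ (T ∘ B) →
      (∀ x b → T (X x) → T (B b) → T (Y (x +ₚ b))) → t < card X + card B → t ≤ card Y
    go zero    X B B≤N _ (b , b∈B) _ _ with () ← ≤-trans (card-nonempty B b b∈B) B≤N
    go (suc N) X B B≤N (x₀ , x₀∈X) (b₀ , b₀∈B) X+B⊆Y t< with
      any? (λ x → any? λ b → any? λ c →
        T? (X x) ×-dec (T? (B b) ×-dec (T? (B c) ×-dec ¬? (T? (X (c +ₚ (x +ₚ -ₚ b)))))))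
    -- Dyson's e-transform with e = x − b.
    ... | yes (x , b , c , x∈X , b∈B , c∈B , c+e∉X) =
      go N X′ B′ (≤-pred (≤-trans B′<B B≤N))
        (x , Equivalence.from T-∨ (inj₁ x∈X)) (b , b∈B′) X′+B′⊆Y
        (subst (t <_) (sym card-sum) t<)
      where
      e = x +ₚ -ₚ b
      X′ B′ : Fin p → Bool
      X′ y = X y ∨ B (y +ₚ -ₚ e)
      B′ z = B z ∧ X (z +ₚ e)

      -- Since `b + e = x`, the element `b` survives in `B′`, whereas `c` drops out: `B′` is
      -- nonempty and strictly smaller than `B`.
      b∈B′ : T (B′ b)
      b∈B′ = Equivalence.from T-∧ (b∈B ,
        subst (T ∘ X) (sym (trans (+ₚ-comm b e) (//-rightDividesˡ b x))) x∈X)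

      B′<B : card B′ < card B
      B′<B = ∑-mono-< (λ z → χ-mono {B′ z} (proj₁ ∘ Equivalence.to T-∧)) c strict
        where
        strict : χ (B′ c) < χ (B c)
        strict = ≤-trans (s≤s (χ-mono {B′ c} {false} (c+e∉X ∘ proj₂ ∘ Equivalence.to (T-∧ {B c}))))
          (χ-mono {true} {B c} (λ _ → c∈B))

      -- Translating `B′` by `e` gives `(B + e) ∩ X`, while `X′` is `X ∪ (B + e)`;
      -- inclusion-exclusion then applies.
      card-sum : card X′ + card B′ ≡ card X + card B
      card-sum = begin
        card X′ + card B′
          ≡⟨ cong (card X′ +_) (sum-cong-≗ λ z → cong (λ w → χ (B w ∧ X (z +ₚ e))) (sym (//-rightDividesʳ e z))) ⟩
        card X′ + ∑[ z < p ] χ (B ((z +ₚ e) +ₚ -ₚ e) ∧ X (z +ₚ e))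
          ≡⟨ cong (card X′ +_) (∑-translate (λ y → χ (B (y +ₚ -ₚ e) ∧ X y)) e) ⟩
        card X′ + ∑[ y < p ] χ (B (y +ₚ -ₚ e) ∧ X y)
          ≡⟨ ∑-distrib-+ (χ ∘ X′) _ ⟨
        ∑[ y < p ] (χ (X′ y) + χ (B (y +ₚ -ₚ e) ∧ X y))
          ≡⟨ sum-cong-≗ (λ y → χ-∨∧ (X y) (B (y +ₚ -ₚ e))) ⟩
        ∑[ y < p ] (χ (X y) + χ (B (y +ₚ -ₚ e)))
          ≡⟨ ∑-distrib-+ (χ ∘ X) _ ⟩
        card X + ∑[ y < p ] χ (B (y +ₚ -ₚ e))
          ≡⟨ cong (card X +_) (∑-translate (χ ∘ B) (-ₚ e)) ⟩
        card X + card B ∎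
        where open ≡-Reasoning

      X′+B′⊆Y : ∀ y z → T (X′ y) → T (B′ z) → T (Y (y +ₚ z))
      X′+B′⊆Y y z y∈X′ z∈B′ with Equivalence.to (T-∨ {X y}) y∈X′ | Equivalence.to (T-∧ {B z}) z∈B′
      ... | inj₁ y∈X   | z∈B , _     = X+B⊆Y y z y∈X z∈B
      ... | inj₂ y-e∈B | _   , z+e∈X = subst (T ∘ Y) eq (X+B⊆Y (z +ₚ e) (y +ₚ -ₚ e) z+e∈X y-e∈B)
        where
        open ≡-Reasoning
        eq : (z +ₚ e) +ₚ (y +ₚ -ₚ e) ≡ y +ₚ z
        eq = begin
          (z +ₚ e) +ₚ (y +ₚ -ₚ e)   ≡⟨ x∙yz≈y∙xz (z +ₚ e) y (-ₚ e) ⟩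
          y +ₚ ((z +ₚ e) +ₚ -ₚ e)   ≡⟨ cong (y +ₚ_) (//-rightDividesʳ e z) ⟩
          y +ₚ z                    ∎
    -- Now `X` is closed under adding differences of elements of `B`. Either `B` is just `b₀`, or
    -- some difference is nonzero and `X` is the whole group.
    ... | no ¬bad with any? (λ b → T? (B b) ×-dec ¬? (b ≟ b₀))
    ...   | no ¬other = ≤-pred (begin
      suc t             ≤⟨ t< ⟩
      card X + card B   ≤⟨ +-mono-≤ X≤Y B≤1 ⟩
      card Y + 1        ≡⟨ +-comm (card Y) 1 ⟩
      suc (card Y)      ∎)
      where
      open ≤-Reasoning
      B≤1 : card B ≤ 1
      B≤1 = card-subsingleton B b₀ λ b b∈B → decidable-stable (b ≟ b₀) λ b≢b₀ → ¬other (b , b∈B , b≢b₀)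
      X≤Y : card X ≤ card Y
      X≤Y = ≤-trans (card-mono {g = λ x → Y (x +ₚ b₀)} λ x x∈X → X+B⊆Y x b₀ x∈X b₀∈B)
        (≤-reflexive (∑-translate (χ ∘ Y) b₀))
    ...   | yes (b , b∈B , b≢b₀) = ≤-trans t≤p (card-universal Y λ y →
        subst (T ∘ Y) (//-rightDividesˡ b₀ y) (X+B⊆Y (y +ₚ -ₚ b₀) b₀ (X-universal _) b₀∈B))
      where
      X-universal : ∀ y → T (X y)
      X-universal = translation-closed⇒universal p-prime X (b +ₚ -ₚ b₀) (b≢b₀ ∘ x∙y⁻¹≈ε⇒x≈y b b₀)
        (λ x x∈X → subst (T ∘ X) (x∙yz≈y∙xz b x (-ₚ b₀))
          (decidable-stable (T? _) λ ∉X → ¬bad (x , b₀ , b , x∈X , b₀∈B , b∈B , ∉X)))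
        x₀ x₀∈X

  -- Overlaps of a set with its translates

  loss : (Fin p → Bool) → Fin p → ℕ
  loss A d = ∑[ x < p ] χ (A x ∧ not (A (x +ₚ d)))

  -- If `x ∈ A` and `x + d + e ∉ A`, then either `x + d ∉ A`, or `x + d` is a point of `A` that the
  -- shift by `e` moves out of `A`.
  loss-subadditive : ∀ A d e → loss A (d +ₚ e) ≤ loss A d + loss A e
  loss-subadditive A d e = begin
    ∑[ x < p ] χ (A x ∧ not (A (x +ₚ (d +ₚ e))))
      ≡⟨ sum-cong-≗ (λ x → cong (λ z → χ (A x ∧ not (A z))) (+ₚ-assoc x d e)) ⟨
    ∑[ x < p ] χ (A x ∧ not (A ((x +ₚ d) +ₚ e)))
      ≤⟨ ∑-mono-≤ (λ x → χ-∧-not-triangle (A x) (A (x +ₚ d)) (A ((x +ₚ d) +ₚ e))) ⟩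
    ∑[ x < p ] (χ (A x ∧ not (A (x +ₚ d))) + χ (A (x +ₚ d) ∧ not (A ((x +ₚ d) +ₚ e))))
      ≡⟨ ∑-distrib-+ (λ x → χ (A x ∧ not (A (x +ₚ d)))) _ ⟩
    loss A d + ∑[ x < p ] χ (A (x +ₚ d) ∧ not (A ((x +ₚ d) +ₚ e)))
      ≡⟨ cong (loss A d +_) (∑-translate (λ y → χ (A y ∧ not (A (y +ₚ e)))) d) ⟩
    loss A d + loss A e ∎
    where open ≤-Reasoning

  -- The number of representations of `d` as a difference of two elements of `A`.
  common : (Fin p → Bool) → Fin p → ℕ
  common A d = ∑[ x < p ] χ (A x ∧ A (x +ₚ d))

  common+loss : ∀ A d → common A d + loss A d ≡ card A
  common+loss A d = trans (sym (∑-distrib-+ (λ x → χ (A x ∧ A (x +ₚ d))) _))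
    (sum-cong-≗ λ x → χ-∧-split (A x) (A (x +ₚ d)))

  -- Double counting: each ordered pair of elements of `A` has exactly one difference.
  ∑-common : ∀ A → ∑[ d < p ] common A d ≡ card A * card A
  ∑-common A = begin
    ∑[ d < p ] ∑[ x < p ] χ (A x ∧ A (x +ₚ d))
      ≡⟨ ∑-comm (λ d x → χ (A x ∧ A (x +ₚ d))) ⟩
    ∑[ x < p ] ∑[ d < p ] χ (A x ∧ A (x +ₚ d))
      ≡⟨ sum-cong-≗ inner ⟩
    ∑[ x < p ] (χ (A x) * card A)
      ≡⟨ *-distribʳ-sum (card A) (χ ∘ A) ⟨
    card A * card A ∎
    where
    open ≡-Reasoning
    inner : ∀ x → ∑[ d < p ] χ (A x ∧ A (x +ₚ d)) ≡ χ (A x) * card A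
    inner x = begin
      ∑[ d < p ] χ (A x ∧ A (x +ₚ d))
        ≡⟨ sum-cong-≗ (λ d → trans (χ-∧ (A x) _) (cong (λ z → χ (A x) * χ (A z)) (+ₚ-comm x d))) ⟩
      ∑[ d < p ] (χ (A x) * χ (A (d +ₚ x)))
        ≡⟨ *-distribˡ-sum (χ (A x)) (λ d → χ (A (d +ₚ x))) ⟨
      χ (A x) * ∑[ d < p ] χ (A (d +ₚ x))
        ≡⟨ cong (χ (A x) *_) (∑-translate (χ ∘ A) x) ⟩
      χ (A x) * card A ∎

  -- Growth of the sublevel sets of the loss

  level : (Fin p → Bool) → ℕ → ℕ → Fin p → Bool
  level A q k d = loss A d ≤ᵇ k * q

  loss-0 : ∀ A → loss A [ 0 ] ≡ 0
  loss-0 A = n≤0⇒n≡0 (+-cancelˡ-≤ (card A) _ _ (begin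
    card A + loss A [ 0 ]          ≡⟨ cong (_+ loss A [ 0 ]) common-0 ⟨
    common A [ 0 ] + loss A [ 0 ]  ≡⟨ common+loss A [ 0 ] ⟩
    card A                         ≡⟨ +-identityʳ (card A) ⟨
    card A + 0                     ∎))
    where
    open ≤-Reasoning
    common-0 : common A [ 0 ] ≡ card A
    common-0 = sum-cong-≗ λ x →
      trans (cong (λ z → χ (A x ∧ A z)) (+ₚ-identityʳ x)) (cong χ (∧-idem (A x)))

  level-0 : ∀ A q k → T (level A q k [ 0 ])
  level-0 A q k = ≤⇒≤ᵇ (≤-trans (≤-reflexive (loss-0 A)) z≤n)

  level-+ : ∀ A q k d e → T (level A q k d) → T (level A q 1 e) → T (level A q (suc k) (d +ₚ e))
  level-+ A q k d e d∈ e∈ = ≤⇒≤ᵇ (begin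
    loss A (d +ₚ e)        ≤⟨ loss-subadditive A d e ⟩
    loss A d + loss A e    ≤⟨ +-mono-≤ (≤ᵇ⇒≤ (loss A d) _ d∈) (≤ᵇ⇒≤ (loss A e) _ e∈) ⟩
    k * q + 1 * q          ≡⟨ trans (cong (k * q +_) (*-identityˡ q)) (+-comm (k * q) q) ⟩
    q + k * q              ∎)
    where open ≤-Reasoning

  -- By subadditivity, level `k` plus level 1 lies in level `k + 1`, so each use of Cauchy-Davenport
  -- gains `c`: (1 + kc) + (1 + c) - 1 = 1 + (k + 1)c. The conditions on `p` reflect that no set has
  -- more than `p` elements.
  card-level : Prime p → ∀ A q c → (suc c ≤ p → suc c ≤ card (level A q 1)) →
    ∀ k → suc (k * c) ≤ p → suc (k * c) ≤ card (level A q k)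
  card-level p-prime A q c base zero    _ = card-nonempty (level A q 0) [ 0 ] (level-0 A q 0)
  card-level p-prime A q c base (suc k) h =
    cauchy-davenport p-prime (level A q k) (level A q 1) (level A q (suc k))
      ([ 0 ] , level-0 A q k) ([ 0 ] , level-0 A q 1) (level-+ A q k) _ h
      (begin
        suc (suc (c + k * c))   ≡⟨ e c (k * c) ⟩
        suc (k * c) + suc c     ≤⟨ +-mono-≤ (card-level p-prime A q c base k (≤-trans (s≤s (m≤n+m (k * c) c)) h))
                                           (base (≤-trans (s≤s (m≤m+n c (k * c))) h)) ⟩
        card (level A q k) + card (level A q 1) ∎)
    where
    open ≤-Reasoning
    e : ∀ c x → suc (suc (c + x)) ≡ suc x + suc c
    e = solve-∀

  -- Exchanging summations, the layers contribute `q * card (level A q k)` for each `k < s`, and the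
  -- sum of 1 + 2kQ over these `k` is s + s(s - 1)Q with `Q = suc q`. The negative term appears on
  -- the right as `q * s * suc q`.
  ∑-layers-loss-≥ : ∀ A q s →
    (∀ k → k < s → suc (k * (2 * suc q)) ≤ card (level A q k)) →
    q * (s + s * s * suc q) ≤ ∑[ d < p ] layers q s (loss A d) + q * s * suc q
  ∑-layers-loss-≥ A q zero    h = ≤-trans (≤-reflexive (*-zeroʳ q)) z≤n
  ∑-layers-loss-≥ A q (suc s) h = begin
    q * (suc s + suc s * suc s * suc q)
      ≡⟨ e₁ q s ⟩
    q * (s + s * s * suc q) + q * suc (s * (2 * suc q)) + q * suc q
      ≤⟨ +-monoˡ-≤ (q * suc q) (+-mono-≤
          (∑-layers-loss-≥ A q s (λ k k<s → h k (m<n⇒m<1+n k<s))) (*-monoʳ-≤ q (h s ≤-refl))) ⟩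
    L + q * s * suc q + q * card (level A q s) + q * suc q
      ≡⟨ e₂ L q s (card (level A q s)) ⟩
    L + q * card (level A q s) + q * suc s * suc q
      ≡⟨ cong (λ z → L + z + q * suc s * suc q) (*-distribˡ-sum q (χ ∘ level A q s)) ⟩
    L + ∑[ d < p ] (q * χ (level A q s d)) + q * suc s * suc q
      ≡⟨ cong (_+ q * suc s * suc q) (∑-distrib-+ (λ d → layers q s (loss A d)) _) ⟨
    ∑[ d < p ] layers q (suc s) (loss A d) + q * suc s * suc q ∎
    where
    open ≤-Reasoning
    L = ∑[ d < p ] layers q s (loss A d)
    e₁ : ∀ q s → q * (suc s + suc s * suc s * suc q) ≡
      q * (s + s * s * suc q) + q * suc (s * (2 * suc q)) + q * suc q
    e₁ = solve-∀
    e₂ : ∀ L q s C → L + q * s * suc q + q * C + q * suc q ≡ L + q * C + q * suc s * suc q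
    e₂ = solve-∀

  -- With `s * q + M` equal to `card A`, the layer bound at `loss A d` is exactly `common A d`,
  -- whose sum over `d` is known.
  ∑-layers-loss-≤ : ∀ A q s M → s * q + M ≡ card A →
    ∑[ d < p ] layers q s (loss A d) + M * card (level A q s) ≤ card A * card A
  ∑-layers-loss-≤ A q s M sq+M≡ = begin
    L + M * card (level A q s)
      ≡⟨ cong (L +_) (*-distribˡ-sum M (χ ∘ level A q s)) ⟩
    L + ∑[ d < p ] (M * χ (level A q s d))
      ≡⟨ ∑-distrib-+ (λ d → layers q s (loss A d)) _ ⟨
    ∑[ d < p ] (layers q s (loss A d) + M * χ (level A q s d))
      ≤⟨ ∑-mono-≤ (λ d → ≤-trans (layers-≤ q s M (loss A d)) (≤-reflexive (residue d))) ⟩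
    ∑[ d < p ] common A d
      ≡⟨ ∑-common A ⟩
    card A * card A ∎
    where
    open ≤-Reasoning
    L = ∑[ d < p ] layers q s (loss A d)
    residue : ∀ d → (s * q + M) ∸ loss A d ≡ common A d
    residue d = trans (cong (_∸ loss A d) (trans sq+M≡ (sym (common+loss A d))))
      (m+n∸n≡m (common A d) (loss A d))

  -- From the restricted sumset to the contradiction

  -- With `d = b - b′`, the left side is the size of `A ∪ (A - d)`. Translated by `b`, this union
  -- becomes `(A + b) ∪ (A + b′)`, which lies in `S` apart from at most two points.
  loss-difference : ∀ (A S : Fin p → Bool) {b b′ a a′} →
    (∀ x → T (A x) → x ≡ a ⊎ T (S (x +ₚ b))) →
    (∀ x → T (A x) → x ≡ a′ ⊎ T (S (x +ₚ b′))) →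
    loss A (b +ₚ -ₚ b′) + card A ≤ card S + 2
  loss-difference A S {b} {b′} {a} {a′} h h′ = begin
    loss A d + card A
      ≡⟨ cong (loss A d +_) (∑-translate (χ ∘ A) d) ⟨
    loss A d + ∑[ x < p ] χ (A (x +ₚ d))
      ≡⟨ ∑-distrib-+ (λ x → χ (A x ∧ not (A (x +ₚ d)))) _ ⟨
    ∑[ x < p ] (χ (A x ∧ not (A (x +ₚ d))) + χ (A (x +ₚ d)))
      ≤⟨ ∑-mono-≤ (λ x → covered (A x) (A (x +ₚ d)) (h₁ x) (h₂ x)) ⟩
    ∑[ x < p ] (χ (S (x +ₚ b)) + (χ (lookup ⁅ a ⁆ x) + χ (lookup ⁅ a′ ⁆ (x +ₚ d))))
      ≡⟨ ∑-distrib-+ (λ x → χ (S (x +ₚ b))) _ ⟩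
    ∑[ x < p ] χ (S (x +ₚ b)) + ∑[ x < p ] (χ (lookup ⁅ a ⁆ x) + χ (lookup ⁅ a′ ⁆ (x +ₚ d)))
      ≡⟨ cong₂ _+_ (∑-translate (χ ∘ S) b) (∑-distrib-+ (χ ∘ lookup ⁅ a ⁆) _) ⟩
    card S + (card (lookup ⁅ a ⁆) + ∑[ x < p ] χ (lookup ⁅ a′ ⁆ (x +ₚ d)))
      ≡⟨ cong (λ z → card S + (card (lookup ⁅ a ⁆) + z)) (∑-translate (χ ∘ lookup ⁅ a′ ⁆) d) ⟩
    card S + (card (lookup ⁅ a ⁆) + card (lookup ⁅ a′ ⁆))
      ≡⟨ cong (card S +_) (cong₂ _+_ (card-⁅⁆ a) (card-⁅⁆ a′)) ⟩
    card S + 2 ∎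
    where
    open ≤-Reasoning
    d = b +ₚ -ₚ b′

    h₁ : ∀ x → T (A x) → T (S (x +ₚ b)) ⊎ T (lookup ⁅ a ⁆ x)
    h₁ x x∈A with h x x∈A
    ... | inj₁ eq = inj₂ (≡⇒T⁅⁆ eq)
    ... | inj₂ s  = inj₁ s

    h₂ : ∀ x → T (A (x +ₚ d)) → T (S (x +ₚ b)) ⊎ T (lookup ⁅ a′ ⁆ (x +ₚ d))
    h₂ x m with h′ (x +ₚ d) m
    ... | inj₁ eq = inj₂ (≡⇒T⁅⁆ eq)
    ... | inj₂ s  = inj₁ (subst (T ∘ S)
      (trans (+ₚ-assoc x d b′) (cong (x +ₚ_) (//-rightDividesˡ b′ b))) s)

    covered : ∀ u v {s e e′} → (T u → T s ⊎ T e) → (T v → T s ⊎ T e′) →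
      χ (u ∧ not v) + χ v ≤ χ s + (χ e + χ e′)
    covered true  true  {s} {e} {e′} _ k = ≤-trans (χ-⊎ {s} (k _)) (+-monoʳ-≤ (χ s) (m≤n+m (χ e′) (χ e)))
    covered false true  {s} {e} {e′} _ k = ≤-trans (χ-⊎ {s} (k _)) (+-monoʳ-≤ (χ s) (m≤n+m (χ e′) (χ e)))
    covered true  false {s} {e} {e′} k _ = ≤-trans (χ-⊎ {s} (k _)) (+-monoʳ-≤ (χ s) (m≤m+n (χ e) (χ e′)))
    covered false false _ _ = z≤n

  -- By contradiction, for any `S` that misses at most the one sum `τ b + b` from each translate
  -- `A + b`.
  restricted-sum-bound : Prime p → (A B S : Fin p → Bool) (τ : Fin p → Fin p) → ∃ (T ∘ B) →
    2 * card A < p → (card B ∸ 1) * (card B ∸ 1) < card A →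
    (∀ x b → T (A x) → T (B b) → x ≡ τ b ⊎ T (S (x +ₚ b))) →
    card A + card B ≤ card S + 3
  restricted-sum-bound p-prime A B S τ (b₀ , b₀∈B) 2m<p n²<m A+B⊆S =
    ≮⇒≥ λ lt → case-small lt (m≤n⇒∃[o]m+o≡n (2≤n lt))
    where
    m = card A
    n = card B

    m+loss : ∀ b b′ → T (B b) → T (B b′) → loss A (b +ₚ -ₚ b′) + m ≤ card S + 2
    m+loss b b′ b∈B b′∈B = loss-difference A S
      (λ x x∈A → A+B⊆S x b x∈A b∈B) (λ x x∈A → A+B⊆S x b′ x∈A b′∈B)

    -- The pair `b₀`, `b₀` already gives `m ≤ card S + 2`, so a counterexample needs `n ≥ 2` and
    -- `q = n - 2` is a genuine difference.
    2≤n : card S + 3 < m + n → 2 ≤ n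
    2≤n lt = +-cancelˡ-≤ (card S + 2) 2 n (begin
      card S + 2 + 2     ≡⟨ e (card S) ⟩
      suc (card S + 3)   ≤⟨ lt ⟩
      m + n              ≤⟨ +-monoˡ-≤ n (≤-trans (m≤n+m m _) (m+loss b₀ b₀ b₀∈B b₀∈B)) ⟩
      card S + 2 + n     ∎)
      where
      open ≤-Reasoning
      e : ∀ x → x + 2 + 2 ≡ suc (x + 3)
      e = solve-∀

    case-small : card S + 3 < m + n → ∃ (λ q → 2 + q ≡ n) → ⊥
    case-small lt (q , 2+q≡n) = quadratic-gap q t r L (card (level A q s)) r≤q
        (subst (λ s → q * (s + s * s * Q) ≤ L + q * s * Q) s≡
          (∑-layers-loss-≥ A q s λ k k<s → levels k (<⇒≤ k<s)))
        (subst (λ s′ → suc (s′ * (2 * Q)) ≤ card (level A q s)) s≡ (levels s ≤-refl))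
        (subst₂ (λ s′ m′ → L + (s′ + r) * card (level A q s) ≤ m′ * m′) s≡ m≡
          -- The top height is `s + r` because `s * q + (s + r) = s * Q + r = m`.
          (∑-layers-loss-≤ A q s (s + r) (trans (e₁ s q r) (sym m≡r+sQ))))
      where
      Q = suc q
      s = m / Q
      r = m % Q
      L = ∑[ d < p ] layers q s (loss A d)

      r≤q : r ≤ q
      r≤q = ≤-pred (m%n<n m Q)

      m≡r+sQ : m ≡ r + s * Q
      m≡r+sQ = m≡m%n+[m/n]*n m Q

      e₁ : ∀ s q r → s * q + (s + r) ≡ r + s * suc q
      e₁ = solve-∀

      -- As `Q = n - 1`, the assumption that `B` is small reads `Q * Q < m`; dividing by `Q` gives
      -- the claim.
      Q≤s : Q ≤ s
      Q≤s = begin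
        Q           ≡⟨ m*n/n≡m Q Q ⟨
        Q * Q / Q   ≤⟨ /-monoˡ-≤ Q (<⇒≤ (subst (λ n → (n ∸ 1) * (n ∸ 1) < m) (sym 2+q≡n) n²<m)) ⟩
        m / Q       ∎
        where open ≤-Reasoning

      t = proj₁ (m≤n⇒∃[o]m+o≡n Q≤s)

      s≡ : s ≡ Q + t
      s≡ = sym (proj₂ (m≤n⇒∃[o]m+o≡n Q≤s))

      m≡ : m ≡ (Q + t) * Q + r
      m≡ = trans m≡r+sQ (trans (+-comm r (s * Q)) (cong (λ s → s * Q + r) s≡))

      loss≤q : ∀ b b′ → T (B b) → T (B b′) → loss A (b +ₚ -ₚ b′) ≤ q
      loss≤q b b′ b∈B b′∈B = +-cancelʳ-≤ (m + 2) _ _ (begin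
        l + (m + 2)        ≡⟨ +-assoc l m 2 ⟨
        l + m + 2          ≤⟨ +-monoˡ-≤ 2 (m+loss b b′ b∈B b′∈B) ⟩
        card S + 2 + 2     ≡⟨ e (card S) ⟩
        suc (card S + 3)   ≤⟨ lt ⟩
        m + n              ≡⟨ cong (m +_) 2+q≡n ⟨
        m + (2 + q)        ≡⟨ e′ m q ⟩
        q + (m + 2)        ∎)
        where
        open ≤-Reasoning
        l = loss A (b +ₚ -ₚ b′)
        e : ∀ x → x + 2 + 2 ≡ suc (x + 3)
        e = solve-∀
        e′ : ∀ m q → m + (2 + q) ≡ q + (m + 2)
        e′ = solve-∀

      -- All of `B - B` lies in level 1, and Cauchy-Davenport for `B` and `-B` yields 2n - 1 = 2Q +
      -- 1 residues.
      level-1 : suc (2 * Q) ≤ p → suc (2 * Q) ≤ card (level A q 1)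
      level-1 h = cauchy-davenport p-prime B (B ∘ -ₚ_) (level A q 1)
        (b₀ , b₀∈B) (-ₚ b₀ , subst (T ∘ B) (sym (⁻¹-involutive b₀)) b₀∈B)
        (λ b c b∈B -c∈B → ≤⇒≤ᵇ (begin
          loss A (b +ₚ c)          ≡⟨ cong (λ z → loss A (b +ₚ z)) (⁻¹-involutive c) ⟨
          loss A (b +ₚ -ₚ (-ₚ c))  ≤⟨ loss≤q b (-ₚ c) b∈B -c∈B ⟩
          q                        ≡⟨ *-identityˡ q ⟨
          1 * q                    ∎))
        _ h
        (begin
          suc (suc (2 * Q))              ≡⟨ e q ⟩
          (2 + q) + (2 + q)              ≡⟨ cong₂ _+_ 2+q≡n (trans 2+q≡n (sym (card-negate B))) ⟩
          card B + card (B ∘ -ₚ_)        ∎)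
        where
        open ≤-Reasoning
        e : ∀ q → suc (suc (2 * suc q)) ≡ (2 + q) + (2 + q)
        e = solve-∀

      -- The assumption `2 * m < p` enters here: for `k ≤ s` the required size is at most
      -- `2 * m + 1`, hence at most `p`.
      levels : ∀ k → k ≤ s → suc (k * (2 * Q)) ≤ card (level A q k)
      levels k k≤s = card-level p-prime A q (2 * Q) level-1 k (≤-trans (s≤s (begin
        k * (2 * Q)   ≤⟨ *-monoˡ-≤ (2 * Q) k≤s ⟩
        s * (2 * Q)   ≡⟨ e s Q ⟩
        2 * (s * Q)   ≤⟨ *-monoʳ-≤ 2 (m/n*n≤m m Q) ⟩
        2 * m         ∎)) 2m<p)
        where
        open ≤-Reasoning
        e : ∀ s Q → s * (2 * Q) ≡ 2 * (s * Q)
        e = solve-∀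

-- The bound on `B` is |B| < √|A| + 1 in squared form, and the 3 is moved to the right to avoid
-- truncated subtraction. The mapping from `B` to `A` is encoded as a total map sending `B` into
-- `A`.
theorem5 : (p : ℕ) .{{_ : NonZero p}} → Prime p →
    (A B : Subset p) → Nonempty A → Nonempty B →
    2 * ∣ A ∣ < p →
    (∣ B ∣ ∸ 1) * (∣ B ∣ ∸ 1) < ∣ A ∣ →
    (τ : Fin p → Fin p) → (∀ b → b ∈ B → τ b ∈ A) →
    ∣ A ∣ + ∣ B ∣ ≤ ∣ restrictedSumset A B τ ∣ + 3
theorem5 p p-prime A B _ (b , b∈B) 2∣A∣<p ∣B∣²<∣A∣ τ _
  rewrite ∣∣≡card A | ∣∣≡card B | ∣tabulate∣≡card (λ x → does (isRestrictedSum? A B τ x)) =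
  restricted-sum-bound p-prime (lookup A) (lookup B) _ τ (b , ∈⇒T b∈B) 2∣A∣<p ∣B∣²<∣A∣ covers
  where
  covers : ∀ x b → T (lookup A x) → T (lookup B b) →
    x ≡ τ b ⊎ T (does (isRestrictedSum? A B τ (x +ₚ b)))
  covers x b x∈A b∈B with x ≟ τ b
  ... | yes eq = inj₁ eq
  ... | no ≢τb = inj₂ (Equivalence.from T-≡ (dec-true (isRestrictedSum? A B τ (x +ₚ b))
    (x , b , T⇒∈ x∈A , T⇒∈ b∈B , ≢τb , refl)))
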